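{- Let $G$ be a finite simple graph with $n(G)\ge 3$ vertices, and let $\widehat{G}$ be the graph obtained from $G$ by adding a new vertex $w$ adjacent to every vertex of $G$, and then, for each vertex $u\in V(G)\cup\{w\}$, adding $\lceil\log_2(n(G)+1)\rceil+1$ new pendant vertices adjacent to $u$ (each such new vertex having $u$ as its only neighbor). Then $$\gamma_{Zg}(\widehat{G})=\gamma(\widehat{G})=\frac{\gamma_g(\widehat{G})+1}{2}.$$
   Context: Graphs are finite and simple; $n(G)$ is the number of vertices of $G$. $N(v)$ and $N[v]=N(v)\cup\{v\}$ denote the open and closed neighborhood of a vertex $v$. The domination number $\gamma(G)$ is the minimum cardinality of a set $S\subseteq V(G)$ with $\bigcup_{v\in S}N[v]=V(G)$. Games: two players, Dominator and Staller, alternately select vertices $v_1,v_2,\ldots$ of an isolate-free graph $G$. In the domination game the $i$-th move $v_i$ is legal if $N[v_i]\setminus\bigcup_{j=1}^{i-1}N[v_j]\neq\emptyset$. In the Z-domination game the $i$-th move $v_i$ is legal if $N(v_i)\setminus\bigcup_{j=1}^{i-1}N[v_j]\neq\emptyset$. Each game ends when no legal move is available. Dominator wants to minimize the total number of moves, Staller wants to maximize it. When Dominator moves first and both players play optimally, the total number of moves played (by both players) is $\gamma_g(G)$ for the domination game and $\gamma_{Zg}(G)$ for the Z-domination game. -}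

module Defs where

open import Data.Bool.Base using (true)
open import Data.Fin.Base using (Fin; zero; suc)
import Data.Fin.Properties as Fin
open import Data.Fin.Subset using (Subset; _∈_; _⊂_; _⊃_; ∣_∣; ⊤)
open import Data.Fin.Subset.Induction using (⊃-wellFounded)
open import Data.Fin.Subset.Properties using (_∈?_; ∈⊤; anySubset?)
open import Data.List.Base using (List; []; _∷_)
open import Data.List.Relation.Unary.Any using (Any; here; there)
import Data.List.Relation.Unary.Any as Any
open import Data.Maybe.Base using (Maybe; just; nothing)
open import Data.Nat.Base using (ℕ; zero; suc; _+_; _*_; _≤_)
import Data.Nat.Properties as ℕ
open import Data.Nat.Induction using (<-rec)
open import Data.Nat.Logarithm using (⌈log₂_⌉)
open import Data.Product.Base using (∃; _×_; _,_; proj₁; proj₂)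
open import Data.Product.Function.NonDependent.Propositional using (_×-↔_)
open import Data.Sum.Base using (_⊎_; inj₁; inj₂)
open import Data.Sum.Function.Propositional using (_⊎-↔_)
open import Data.Vec.Base using (tabulate)
open import Data.Vec.Properties using (lookup∘tabulate; lookup⇒[]=; []=⇒lookup)
open import Function.Base using (_∘_; case_of_)
open import Function.Bundles using (_↔_; Inverse; mk↔ₛ′)
open import Function.Construct.Composition using (_↔-∘_)
open import Function.Construct.Identity using (↔-id)
open import Induction.WellFounded using (Acc; acc)
open import Level using (0ℓ)
open import Relation.Binary.Core using (Rel)
open import Relation.Binary.Definitions using (Decidable; Symmetric; Irreflexive; DecidableEquality)
open import Relation.Binary.PropositionalEquality
  using (_≡_; refl; sym; trans; cong; subst)
open import Relation.Nullary using (Dec; yes; no; ¬_; does; contradiction)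
open import Relation.Nullary.Decidable using (map′; ¬?; _×-dec_; _⊎-dec_; dec-true)
import Relation.Unary as U

record Graph : Set₁ where
  infix 4 _~_ _~?_
  field
    V        : Set
    order    : ℕ
    vertices : Fin order ↔ V
    _~_      : Rel V 0ℓ
    _~?_     : Decidable _~_
    ~-sym    : Symmetric _~_
    ~-irrefl : Irreflexive _≡_ _~_

  open Inverse vertices public
    using () renaming (to to vertex; from to index)

  vertex-index : ∀ v → vertex (index v) ≡ v
  vertex-index v = Inverse.inverseˡ vertices refl

  index-injective : ∀ {u v} → index u ≡ index v → u ≡ v
  index-injective {u} {v} eq =
    trans (sym (vertex-index u)) (trans (cong vertex eq) (vertex-index v))

  infix 4 _≟ⱽ_
  _≟ⱽ_ : DecidableEquality V
  u ≟ⱽ v = map′ index-injective (cong index) (index u Fin.≟ index v)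

  anyVertex? : {P : U.Pred V 0ℓ} → U.Decidable P → Dec (∃ P)
  anyVertex? {P} P? = map′
    (λ (i , p) → vertex i , p)
    (λ (v , p) → index v , subst P (sym (vertex-index v)) p)
    (Fin.any? (P? ∘ vertex))

  allVertices? : {P : U.Pred V 0ℓ} → U.Decidable P → Dec (∀ v → P v)
  allVertices? {P} P? = map′
    (λ f v → subst P (vertex-index v) (f (index v)))
    (λ f i → f (vertex i))
    (Fin.all? (P? ∘ vertex))

  infix 4 _∈N⟨_⟩ _∈N[_] _∈N[_]?

  _∈N⟨_⟩ : Rel V 0ℓ
  u ∈N⟨ v ⟩ = v ~ u

  _∈N[_] : Rel V 0ℓ
  u ∈N[ v ] = u ≡ v ⊎ u ∈N⟨ v ⟩

  _∈N[_]? : Decidable _∈N[_]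
  u ∈N[ v ]? = (u ≟ⱽ v) ⊎-dec (v ~? u)

module _ (G : Graph) where
  open Graph G

  -- A vertex set is a subset of the indices of its elements.
  Dominating : Subset order → Set
  Dominating S = ∀ u → ∃ λ v → index v ∈ S × u ∈N[ v ]

  IsDominationNumber : ℕ → Set
  IsDominationNumber m =
    (∃ λ S → Dominating S × ∣ S ∣ ≡ m) × (∀ S → Dominating S → m ≤ ∣ S ∣)

  dominating? : U.Decidable Dominating
  dominating? S =
    allVertices? λ u → anyVertex? λ v → (index v ∈? S) ×-dec (u ∈N[ v ]?)

  dominationNumber-exists : ∃ IsDominationNumber
  dominationNumber-exists =
    descend _ ⊤ (λ u → u , ∈⊤ , inj₁ refl) refl
    where
    descend : ∀ k S → Dominating S → ∣ S ∣ ≡ k → ∃ IsDominationNumber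
    descend = <-rec _ λ k rec S dom eq →
      case anySubset? (λ T → dominating? T ×-dec (∣ T ∣ ℕ.<? k)) of λ where
        (yes (T , domT , T<k)) → rec T<k T domT refl
        (no ¬smaller) → k , (S , dom , eq) ,
          λ T domT → ℕ.≮⇒≥ (λ T<k → ¬smaller (T , domT , T<k))

  γ : ℕ
  γ = proj₁ dominationNumber-exists

data Player : Set where
  dominator staller : Player

opponent : Player → Player
opponent dominator = staller
opponent staller   = dominator

-- `AtLeastAsGood p m n`: player p likes m moves at least as much as n moves.
AtLeastAsGood : Player → Rel ℕ 0ℓ
AtLeastAsGood dominator m n = m ≤ n
AtLeastAsGood staller   m n = n ≤ m

-- `R u v` says that u belongs to the neighbourhood (open or closed) of v in
-- which a move v has to dominate a new vertex.
module Game (G : Graph) {R : Rel (Graph.V G) 0ℓ} (R? : Decidable R)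
            (R⊆N[] : ∀ {u v} → R u v → Graph._∈N[_] G u v) where
  open Graph G

  Dominated : List V → V → Set
  Dominated moves u = Any (λ v → u ∈N[ v ]) moves

  Legal : List V → V → Set
  Legal moves v = ∃ λ u → R u v × ¬ Dominated moves u

  -- `Value p moves m`: once `moves` have been played, with p to move, exactly
  -- m further moves are made under optimal play.  In `move`, `val u` is the
  -- value of the position after u; it is unconstrained for illegal u.
  data Value (p : Player) (moves : List V) : ℕ → Set where
    end  : (∀ v → ¬ Legal moves v) → Value p moves 0
    move : (val : V → ℕ) →
           (∀ u → Legal moves u → Value (opponent p) (u ∷ moves) (val u)) →
           (v : V) → Legal moves v →
           (∀ u → Legal moves u → AtLeastAsGood p (val v) (val u)) →
           Value p moves (suc (val v))

  AtLeastAsGood-antisym : ∀ p {m n} → AtLeastAsGood p m n → AtLeastAsGood p n m → m ≡ n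
  AtLeastAsGood-antisym dominator m≤n n≤m = ℕ.≤-antisym m≤n n≤m
  AtLeastAsGood-antisym staller   n≤m m≤n = ℕ.≤-antisym m≤n n≤m

  Value-unique : ∀ {p moves m n} → Value p moves m → Value p moves n → m ≡ n
  Value-unique (end _) (end _) = refl
  Value-unique (end stuck) (move _ _ v legal _) = contradiction legal (stuck v)
  Value-unique (move _ _ v legal _) (end stuck) = contradiction legal (stuck v)
  Value-unique {p} (move f F v lv bestv) (move g H w lw bestw) =
    cong suc (AtLeastAsGood-antisym p
      (subst (AtLeastAsGood p (f v)) (Value-unique (F w lw) (H w lw)) (bestv w lw))
      (subst (AtLeastAsGood p (g w)) (sym (Value-unique (F v lv) (H v lv))) (bestw v lv)))

  dominated? : ∀ moves → U.Decidable (Dominated moves)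
  dominated? moves u = Any.any? (λ v → u ∈N[ v ]?) moves

  legal? : ∀ moves → U.Decidable (Legal moves)
  legal? moves v = anyVertex? λ u → R? u v ×-dec ¬? (dominated? moves u)

  private
    AtLeastAsGood-refl : ∀ p {m} → AtLeastAsGood p m m
    AtLeastAsGood-refl dominator = ℕ.≤-refl
    AtLeastAsGood-refl staller   = ℕ.≤-refl

    AtLeastAsGood-trans : ∀ p {l m n} →
      AtLeastAsGood p l m → AtLeastAsGood p m n → AtLeastAsGood p l n
    AtLeastAsGood-trans dominator l≤m m≤n = ℕ.≤-trans l≤m m≤n
    AtLeastAsGood-trans staller   m≤l n≤m = ℕ.≤-trans n≤m m≤l

    AtLeastAsGood-total : ∀ p m n → AtLeastAsGood p m n ⊎ AtLeastAsGood p n m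
    AtLeastAsGood-total dominator m n = ℕ.≤-total m n
    AtLeastAsGood-total staller   m n = ℕ.≤-total n m

    best : ∀ p {n} {P : Fin n → Set} → U.Decidable P → (f : Fin n → ℕ) →
           (∀ i → ¬ P i) ⊎
           (∃ λ i → P i × (∀ j → P j → AtLeastAsGood p (f i) (f j)))
    best p {zero}  P? f = inj₁ λ ()
    best p {suc n} P? f with P? zero | best p (P? ∘ suc) (f ∘ suc)
    ... | no ¬p0 | inj₁ none = inj₁ λ { zero → ¬p0 ; (suc i) → none i }
    ... | yes p0 | inj₁ none = inj₂ (zero , p0 , λ where
          zero    _  → AtLeastAsGood-refl p
          (suc j) pj → contradiction pj (none j))
    ... | no ¬p0 | inj₂ (i , pi , opt) = inj₂ (suc i , pi , λ where
          zero    p0 → contradiction p0 ¬p0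
          (suc j) pj → opt j pj)
    ... | yes p0 | inj₂ (i , pi , opt) with AtLeastAsGood-total p (f zero) (f (suc i))
    ...   | inj₁ 0≤i = inj₂ (zero , p0 , λ where
            zero    _  → AtLeastAsGood-refl p
            (suc j) pj → AtLeastAsGood-trans p 0≤i (opt j pj))
    ...   | inj₂ i≤0 = inj₂ (suc i , pi , λ where
            zero    _  → i≤0
            (suc j) pj → opt j pj)

    dominatedSet : List V → Subset order
    dominatedSet moves = tabulate λ i → does (dominated? moves (vertex i))

    ∈-dominatedSet⁺ : ∀ moves i → Dominated moves (vertex i) → i ∈ dominatedSet moves
    ∈-dominatedSet⁺ moves i d = lookup⇒[]= i _
      (trans (lookup∘tabulate _ i) (dec-true (dominated? moves (vertex i)) d))

    ∈-dominatedSet⁻ : ∀ moves i → i ∈ dominatedSet moves → Dominated moves (vertex i)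
    ∈-dominatedSet⁻ moves i i∈ = go (dominated? moves (vertex i))
      (trans (sym (lookup∘tabulate _ i)) ([]=⇒lookup i∈))
      where
      go : ∀ {A : Set} (A? : Dec A) → does A? ≡ true → A
      go (yes a) _ = a

    legal⇒⊂ : ∀ {moves v} → Legal moves v → dominatedSet moves ⊂ dominatedSet (v ∷ moves)
    legal⇒⊂ {moves} {v} (u , Ruv , ¬d) =
      (λ {i} i∈ → ∈-dominatedSet⁺ (v ∷ moves) i (there (∈-dominatedSet⁻ moves i i∈))) ,
      index u ,
      ∈-dominatedSet⁺ (v ∷ moves) (index u)
        (here (subst (_∈N[ v ]) (sym (vertex-index u)) (R⊆N[] Ruv))) ,
      λ i∈ → ¬d (subst (Dominated moves) (vertex-index u) (∈-dominatedSet⁻ moves (index u) i∈))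

    value : ∀ p moves → Acc _⊃_ (dominatedSet moves) → ∃ (Value p moves)
    value p moves (acc rs) =
      case best p (legal? moves ∘ vertex) (val ∘ vertex) of λ where
        (inj₁ none) → 0 , end λ v l →
          none (index v) (subst (Legal moves) (sym (vertex-index v)) l)
        (inj₂ (i , li , opt)) → _ , move val (proj₂ ∘ next) (vertex i) li λ u lu →
          subst (λ x → AtLeastAsGood p (val (vertex i)) (val x)) (vertex-index u)
            (opt (index u) (subst (Legal moves) (sym (vertex-index u)) lu))
      where
      next : ∀ u → ∃ λ m → Legal moves u → Value (opponent p) (u ∷ moves) m
      next u with legal? moves u
      ... | yes l = let m , x = value (opponent p) (u ∷ moves) (rs (legal⇒⊂ l)) in m , λ _ → x
      ... | no ¬l = 0 , λ l → contradiction l ¬l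

      val : V → ℕ
      val = proj₁ ∘ next

  value-exists : ∀ p moves → ∃ (Value p moves)
  value-exists p moves = value p moves (⊃-wellFounded _)

module DominationGame (G : Graph) =
  Game G {Graph._∈N[_] G} (Graph._∈N[_]? G) (λ u∈N[v] → u∈N[v])

module ZDominationGame (G : Graph) =
  Game G {Graph._∈N⟨_⟩ G} (λ u v → Graph._~?_ G v u) inj₂

γg : Graph → ℕ
γg G = proj₁ (DominationGame.value-exists G dominator [])

γZg : Graph → ℕ
γZg G = proj₁ (ZDominationGame.value-exists G dominator [])

module Hat (G : Graph) where
  open Graph G

  pendants : ℕ
  pendants = ⌈log₂ (order + 1) ⌉ + 1

  V̂ : Set
  V̂ = Maybe V ⊎ (Maybe V × Fin pendants)

  pattern old v       = inj₁ (just v)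
  pattern w           = inj₁ nothing
  pattern base u      = inj₁ u
  pattern pendant u i = inj₂ (u , i)

  infix 4 _~̂_
  data _~̂_ : Rel V̂ 0ℓ where
    old-old      : ∀ {u v} → u ~ v → old u ~̂ old v
    w-old        : ∀ {v} → w ~̂ old v
    old-w        : ∀ {v} → old v ~̂ w
    base-pendant : ∀ {u i} → base u ~̂ pendant u i
    pendant-base : ∀ {u i} → pendant u i ~̂ base u

  _≟ᴹ_ : DecidableEquality (Maybe V)
  just u  ≟ᴹ just v  = map′ (cong just) (λ { refl → refl }) (u ≟ⱽ v)
  just _  ≟ᴹ nothing = no λ ()
  nothing ≟ᴹ just _  = no λ ()
  nothing ≟ᴹ nothing = yes refl

  _~̂?_ : Decidable _~̂_
  old u       ~̂? old v       = map′ old-old (λ { (old-old e) → e }) (u ~? v)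
  old _       ~̂? w           = yes old-w
  w           ~̂? old _       = yes w-old
  w           ~̂? w           = no λ ()
  base u      ~̂? pendant v i = map′ (λ { refl → base-pendant }) (λ { base-pendant → refl }) (u ≟ᴹ v)
  pendant u i ~̂? base v      = map′ (λ { refl → pendant-base }) (λ { pendant-base → refl }) (u ≟ᴹ v)
  pendant _ _ ~̂? pendant _ _ = no λ ()

  ~̂-sym : Symmetric _~̂_
  ~̂-sym (old-old e)  = old-old (~-sym e)
  ~̂-sym w-old        = old-w
  ~̂-sym old-w        = w-old
  ~̂-sym base-pendant = pendant-base
  ~̂-sym pendant-base = base-pendant

  ~̂-irrefl : Irreflexive _≡_ _~̂_
  ~̂-irrefl refl (old-old e) = ~-irrefl refl e

  maybe↔ : Fin (suc order) ↔ Maybe V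
  maybe↔ = mk↔ₛ′
    (λ { zero → nothing ; (suc i) → just (vertex i) })
    (λ { nothing → zero ; (just v) → suc (index v) })
    (λ { nothing → refl ; (just v) → cong just (vertex-index v) })
    (λ { zero → refl ; (suc i) → cong suc (Inverse.inverseʳ vertices refl) })

  graph : Graph
  graph = record
    { V        = V̂
    ; order    = suc order + suc order * pendants
    ; vertices = (maybe↔ ⊎-↔ ((maybe↔ ×-↔ ↔-id _) ↔-∘ Fin.*↔×)) ↔-∘ Fin.+↔⊎
    ; _~_      = _~̂_
    ; _~?_     = _~̂?_
    ; ~-sym    = ~̂-sym
    ; ~-irrefl = ~̂-irrefl
    }

hat : Graph → Graph
hat = Hat.graph

{-# OPTIONS --safe #-}
module Submission where

-- Each base vertex u of Ĝ (a vertex of G or w) has private pendants, so a dominating set meets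
-- the star of every u; in particular γ(Ĝ) = n + 1.
--
-- In the Z-domination game Dominator opens with w. From then on only unplayed base vertices are
-- legal, so exactly n more moves follow; the final position is dominating, which gives γ ≤ γ_Zg.
--
-- In the domination game Dominator ends play within 2(n + 1) − 1 moves by going through the base
-- vertices. For the converse let q + 1 be the number of pendants at each u, and let c(u) be the
-- number of pendant moves at u. Before each move of Dominator, Staller keeps Σ 2^c(u), over the
-- unplayed base vertices u, at most 2^q; initially the sum is n + 1 ≤ 2^q. If Dominator plays a
-- base vertex, she plays a pendant where c is least; if he does not, he has wasted a turn and she
-- plays a base vertex herself. The bound leaves an undominated pendant at every unplayed u, so
-- every round but the last, in which one move suffices, takes two moves for one base vertex.

open import Defs
open import Data.Nat.Base using (_≤_; _+_)
open import Data.Integer.Base using (+_)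
open import Data.Rational.Base using (_/_)
open import Data.Product.Base using (_×_)
open import Relation.Binary.PropositionalEquality using (_≡_)

open import Data.Fin.Base using (Fin; zero; suc; _↑ʳ_)
import Data.Fin.Properties as Fin
open import Data.Fin.Subset using (Subset; inside; outside; ⁅_⁆; ⊥; _∪_; ∣_∣; _-_) renaming (_∈_ to _∈ˢ_)
open import Data.Fin.Subset.Properties
  using (∣⊥∣≡0; ∣⁅x⁆∣≡1; x∈⁅x⁆; x∈p∪q⁺; x∈p∧x≢y⇒x∈p-y; x∈p⇒∣p-x∣<∣p∣)
import Data.Integer.Properties as ℤ
open import Data.List.Base using (List; []; _∷_; length; map; filter; tabulate; lookup)
open import Data.List.Extrema.Nat using (argmin; argmin-sel; f[argmin]≤f[⊤]; f[argmin]≤f[xs])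
open import Data.List.Membership.Propositional using (_∈_; _∉_; find; lose)
open import Data.List.Membership.Propositional.Properties using (∈-map⁺; ∈-∃++; ∈-filter⁺; ∈-tabulate⁺)
open import Data.List.Properties using (length-map; length-tabulate; map-cong-local; filter-accept; filter-reject)
open import Data.List.Relation.Binary.Permutation.Propositional using (_↭_; ↭-sym; ↭⇒↭ₛ)
open import Data.List.Relation.Binary.Permutation.Propositional.Properties
  using (∈-resp-↭; ↭-length; shift; map⁺)
import Data.List.Relation.Binary.Permutation.Setoid.Properties as Permutation
open import Data.List.Relation.Unary.All using (_∷_)
import Data.List.Relation.Unary.All as All
open import Data.List.Relation.Unary.AllPairs using (_∷_)
open import Data.List.Relation.Unary.Any using (here; there)
import Data.List.Relation.Unary.Any as Any
open import Data.List.Relation.Unary.Any.Properties using (lookup-index)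
open import Data.List.Relation.Unary.Unique.Propositional using (Unique)
import Data.List.Relation.Unary.Unique.Propositional.Properties as Unique
open import Data.Maybe.Base using (Maybe; nothing)
open import Data.Nat.Base using (ℕ; zero; suc; _*_; _∸_; _^_; _<_; z≤n; s≤s; ⌈_/2⌉)
open import Data.Nat.Divisibility using (_∣_; divides; ∣m∣n⇒∣m+n; m∣m*n; _∣0)
open import Data.Nat.ListAction using (sum)
open import Data.Nat.ListAction.Properties using (sum-↭)
open import Data.Nat.Logarithm using (⌈log₂_⌉)
open import Data.Nat.Logarithm.Core using (⌈log2⌉)
open import Data.Nat.Properties
open import Data.Product.Base using (∃; ∃₂; _,_; proj₁; proj₂)
open import Data.Rational.Properties using (fromℚᵘ-cong)
open import Data.Rational.Unnormalised.Base using (mkℚᵘ; *≡*)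
open import Data.Sum.Base using (_⊎_; inj₁; inj₂)
open import Data.Vec.Base using ([]; _∷_)
open import Function.Base using (_∘_; case_of_)
open import Function.Bundles using (Inverse)
open import Function.Definitions using (Injective)
open import Induction.WellFounded using (Acc; acc)
open import Level using (0ℓ)
open import Relation.Binary.Core using (Rel)
open import Relation.Binary.Definitions using (Decidable)
open import Relation.Binary.PropositionalEquality
  using (refl; sym; trans; cong; cong₂; subst; _≢_; setoid)
open import Relation.Nullary using (yes; no; ¬_; contradiction)
open import Relation.Nullary.Decidable using (¬?; decidable-stable)

-- Arithmetic of powers of two, multiples and halves

n≤2^⌈log₂n⌉ : ∀ n → n ≤ 2 ^ ⌈log₂ n ⌉
n≤2^⌈log₂n⌉ n = go n _
  where
  n≤⌈n/2⌉*2 : ∀ n → n ≤ 2 * ⌈ n /2⌉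
  n≤⌈n/2⌉*2 zero          = z≤n
  n≤⌈n/2⌉*2 (suc zero)    = s≤s z≤n
  n≤⌈n/2⌉*2 (suc (suc n)) =
    ≤-trans (+-monoʳ-≤ 2 (n≤⌈n/2⌉*2 n)) (≤-reflexive (sym (*-suc 2 ⌈ n /2⌉)))

  -- Taking an arbitrary accessibility proof lets the induction follow the recursion that defines
  -- `⌈log2⌉`.
  go : ∀ n (rs : Acc _<_ n) → n ≤ 2 ^ ⌈log2⌉ n rs
  go zero          _        = z≤n
  go (suc zero)    _        = ≤-refl
  go (suc (suc n)) (acc rs) =
    ≤-trans (n≤⌈n/2⌉*2 (suc (suc n))) (*-monoʳ-≤ 2 (go (suc ⌈ n /2⌉) _))

-- Equality of unnormalised fractions is cross-multiplication, and normalising respects it.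
m/1≡n/2 : ∀ m n → m * 2 ≡ n → (+ m) / 1 ≡ (+ n) / 2
m/1≡n/2 m n m*2≡n = fromℚᵘ-cong {mkℚᵘ (+ m) 0} {mkℚᵘ (+ n) 1} (*≡*
  (trans (sym (ℤ.pos-* m 2)) (trans (cong +_ m*2≡n) (sym (ℤ.*-identityʳ (+ n))))))

2^-cancel-≤ : ∀ {m n} → 2 ^ m ≤ 2 ^ n → m ≤ n
2^-cancel-≤ {m} {n} 2^m≤2^n = ≮⇒≥ λ n<m → <⇒≱ (^-monoʳ-< 2 ≤-refl n<m) 2^m≤2^n

2^-cancel-< : ∀ {m n} → 2 ^ m < 2 ^ n → m < n
2^-cancel-< {m} {n} 2^m<2^n = ≰⇒> λ n≤m → <⇒≱ 2^m<2^n (^-monoʳ-≤ 2 n≤m)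

2^-mono-∣ : ∀ {m n} → m ≤ n → 2 ^ m ∣ 2 ^ n
2^-mono-∣ {m} {n} m≤n = subst (2 ^ m ∣_)
  (trans (sym (^-distribˡ-+-* 2 m (n ∸ m))) (cong (2 ^_) (m+[n∸m]≡n m≤n)))
  (m∣m*n (2 ^ (n ∸ m)))

∣∧<⇒+≤ : ∀ {d m n} → d ∣ m → d ∣ n → m < n → d + m ≤ n
∣∧<⇒+≤ {d} (divides a refl) (divides b refl) a*d<b*d =
  *-monoˡ-≤ d (*-cancelʳ-< d a b a*d<b*d)

-- Counting in subsets and lists

∣p∪q∣≤∣p∣+∣q∣ : ∀ {n} (p q : Subset n) → ∣ p ∪ q ∣ ≤ ∣ p ∣ + ∣ q ∣
∣p∪q∣≤∣p∣+∣q∣ []            []            = z≤n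
∣p∪q∣≤∣p∣+∣q∣ (outside ∷ p) (outside ∷ q) = ∣p∪q∣≤∣p∣+∣q∣ p q
∣p∪q∣≤∣p∣+∣q∣ (outside ∷ p) (inside  ∷ q) =
  ≤-trans (s≤s (∣p∪q∣≤∣p∣+∣q∣ p q)) (≤-reflexive (sym (+-suc ∣ p ∣ ∣ q ∣)))
∣p∪q∣≤∣p∣+∣q∣ (inside  ∷ p) (outside ∷ q) = s≤s (∣p∪q∣≤∣p∣+∣q∣ p q)
∣p∪q∣≤∣p∣+∣q∣ (inside  ∷ p) (inside  ∷ q) =
  s≤s (≤-trans (∣p∪q∣≤∣p∣+∣q∣ p q) (+-monoʳ-≤ ∣ p ∣ (n≤1+n ∣ q ∣)))

injective⇒≤∣p∣ : ∀ {k n} {f : Fin k → Fin n} (p : Subset n) →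
                 Injective _≡_ _≡_ f → (∀ i → f i ∈ˢ p) → k ≤ ∣ p ∣
injective⇒≤∣p∣ {zero}          p inj f∈p = z≤n
injective⇒≤∣p∣ {suc k} {f = f} p inj f∈p = ≤-<-trans
  (injective⇒≤∣p∣ (p - f zero) (Fin.suc-injective ∘ inj) λ i →
    x∈p∧x≢y⇒x∈p-y (f∈p (suc i)) (λ eq → contradiction (inj eq) λ ()))
  (x∈p⇒∣p-x∣<∣p∣ (f∈p zero))

module _ {A : Set} where

  -- The positions of the `f i` in `xs` are distinct, as looking up a position recovers `f i`.
  injective⇒≤length : ∀ {k} {f : Fin k → A} (xs : List A) →
                      Injective _≡_ _≡_ f → (∀ i → f i ∈ xs) → k ≤ length xs
  injective⇒≤length xs inj f∈xs = Fin.injective⇒≤ {f = Any.index ∘ f∈xs} λ {i} {j} eq →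
    inj (trans (lookup-index (f∈xs i))
      (trans (cong (lookup xs) eq) (sym (lookup-index (f∈xs j)))))

  ∈⇒↭∷ : ∀ {x} {xs : List A} → x ∈ xs → ∃ λ ys → xs ↭ x ∷ ys
  ∈⇒↭∷ x∈xs with ys , zs , refl ← ∈-∃++ x∈xs = _ , shift _ ys zs

  Unique-resp-↭ : ∀ {xs ys : List A} → xs ↭ ys → Unique xs → Unique ys
  Unique-resp-↭ = Permutation.Unique-resp-↭ (setoid A) ∘ ↭⇒↭ₛ

  minimiser : (f : A → ℕ) (x : A) (xs : List A) →
              ∃ λ m → m ∈ x ∷ xs × (∀ {y} → y ∈ x ∷ xs → f m ≤ f y)
  minimiser f x xs = argmin f x xs , m∈ , λ where
      (here refl)  → f[argmin]≤f[⊤] {f = f} x xs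
      (there y∈xs) → All.lookup (f[argmin]≤f[xs] {f = f} x xs) y∈xs
    where
    m∈ : argmin f x xs ∈ x ∷ xs
    m∈ with argmin-sel f x xs
    ... | inj₁ m≡x  = here m≡x
    ... | inj₂ m∈xs = there m∈xs

-- Lists of vertices as vertex sets

module _ (G : Graph) where
  open Graph G

  γ≤∣S∣ : ∀ {S} → Dominating G S → γ G ≤ ∣ S ∣
  γ≤∣S∣ = proj₂ (proj₂ (dominationNumber-exists G)) _

  indexSet : List V → Subset order
  indexSet []       = ⊥
  indexSet (v ∷ vs) = ⁅ index v ⁆ ∪ indexSet vs

  ∈-indexSet : ∀ {v vs} → v ∈ vs → index v ∈ˢ indexSet vs
  ∈-indexSet (here refl)  = x∈p∪q⁺ (inj₁ (x∈⁅x⁆ _))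
  ∈-indexSet (there v∈vs) = x∈p∪q⁺ (inj₂ (∈-indexSet v∈vs))

  ∣indexSet∣≤length : ∀ vs → ∣ indexSet vs ∣ ≤ length vs
  ∣indexSet∣≤length []       = ≤-reflexive (∣⊥∣≡0 order)
  ∣indexSet∣≤length (v ∷ vs) = ≤-trans (∣p∪q∣≤∣p∣+∣q∣ ⁅ index v ⁆ (indexSet vs))
    (+-mono-≤ (≤-reflexive (∣⁅x⁆∣≡1 (index v))) (∣indexSet∣≤length vs))

-- Optimal play in a general game

module GameProperties (G : Graph) {R : Rel (Graph.V G) 0ℓ} (R? : Decidable R)
                      (R⊆N[] : ∀ {u v} → R u v → Graph._∈N[_] G u v) where
  open Graph G
  open Game G R? R⊆N[]

  -- Serves for the opponent's move: the legal `v` excludes `end`, while the move returned is the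
  -- optimal one, in general not `v`.
  optimal-move : ∀ {p moves m v} → Value p moves m → Legal moves v →
                 ∃₂ λ u k → Value (opponent p) (u ∷ moves) k × m ≡ suc k
  optimal-move (end stuck)              legal = contradiction legal (stuck _)
  optimal-move (move val next u lu opt) _     = u , val u , next u lu , refl

  -- A chosen move is no better than an optimal one, which bounds the value above for Dominator and
  -- below for Staller. Splitting on the player unfolds `AtLeastAsGood`.
  any-move : ∀ {p moves m v} → Value p moves m → Legal moves v →
             ∃ λ k → Value (opponent p) (v ∷ moves) k × AtLeastAsGood p m (suc k)
  any-move (end stuck) legal = contradiction legal (stuck _)
  any-move {dominator} (move val next u lu opt) legal = _ , next _ legal , s≤s (opt _ legal)
  any-move {staller}   (move val next u lu opt) legal = _ , next _ legal , s≤s (opt _ legal)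

  final-position : ∀ {p moves m} → Value p moves m →
                   ∃ λ all → length all ≡ m + length moves × (∀ v → ¬ Legal all v)
  final-position (end stuck) = _ , refl , stuck
  final-position {moves = moves} (move val next v lv _) =
    let all , len , stuck = final-position (next v lv)
    in all , trans len (+-suc (val v) (length moves)) , stuck

  -- The moves of a finished game form a dominating set: an undominated `u` would make some `v` with
  -- `R u v` legal.
  γ≤value : (∀ u → ∃ λ v → R u v) → ∀ {p m} → Value p [] m → γ G ≤ m
  γ≤value R-total {m = m} value =
    let all , len , stuck = final-position value
        dominated u = decidable-stable (dominated? all u) λ ¬d →
          let v , Ruv = R-total u in stuck v (u , Ruv , ¬d)
    in ≤-trans
         (γ≤∣S∣ G λ u → let v , v∈ , u∈N[v] = find (dominated u) in v , ∈-indexSet G v∈ , u∈N[v])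
         (≤-trans (∣indexSet∣≤length G all) (≤-reflexive (trans len (+-identityʳ m))))

-- Domination game: Dominator plays through a covering list

module _ (G : Graph) where
  open Graph G
  open DominationGame G
  open GameProperties G _∈N[_]? (λ u∈N[v] → u∈N[v])

  Covering : List V → List V → Set
  Covering moves L = ∀ u → Dominated moves u ⊎ Dominated L u

  mutual
    -- Each entry of `L` costs at most Dominator's move and one Staller move, and after the last
    -- entry nothing is left to play. Truncated subtraction gives 0 for empty `L`.
    dominator-covers : ∀ {moves m} L → Covering moves L →
                       Value dominator moves m → m ≤ length L * 2 ∸ 1
    dominator-covers [] cov (end _) = z≤n
    dominator-covers [] cov (move _ _ _ (u , _ , ¬d) _) with cov u
    ... | inj₁ d = contradiction d ¬d
    dominator-covers {moves} (v ∷ L) cov value with legal? moves v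
    ... | yes legal =
      let k , value′ , m≤1+k = any-move value legal
      in ≤-trans m≤1+k (s≤s (staller-covered L
           (λ u → case cov u of λ where
             (inj₁ d)         → inj₁ (there d)
             (inj₂ (here d))  → inj₁ (here d)
             (inj₂ (there d)) → inj₂ d)
           value′))
    ... | no illegal = ≤-trans
      (dominator-covers L
        (λ u → case cov u of λ where
          (inj₁ d)             → inj₁ d
          (inj₂ (here u∈N[v])) →
            inj₁ (decidable-stable (dominated? moves u) λ ¬d → illegal (u , u∈N[v] , ¬d))
          (inj₂ (there d))     → inj₂ d)
        value)
      (∸-monoˡ-≤ 1 (m≤n+m (length L * 2) 2))

    staller-covered : ∀ {moves m} L → Covering moves L →
                      Value staller moves m → m ≤ length L * 2
    staller-covered L cov (end _) = z≤n
    staller-covered [] cov (move _ _ _ (u , _ , ¬d) _) with cov u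
    ... | inj₁ d = contradiction d ¬d
    staller-covered (x ∷ L) cov (move _ next v lv _) = s≤s
      (dominator-covers (x ∷ L)
        (λ u → case cov u of λ where
          (inj₁ d) → inj₁ (there d)
          (inj₂ d) → inj₂ d)
        (next v lv))

-- Stars of Ĝ and the lower bound on its domination number

module HatProperties (G : Graph) where
  open Graph G using (V; order)
  open Hat G
  open Graph graph using (_∈N[_]; _∈N[_]?; _∈N⟨_⟩; index-injective)
  open import Data.List.Membership.DecPropositional _≟ᴹ_ using (_∈?_)

  exponent : ℕ
  exponent = ⌈log₂ (order + 1) ⌉

  somePendant : Fin pendants
  somePendant = exponent ↑ʳ zero

  baseAt : Fin (suc order) → Maybe V
  baseAt = Inverse.to maybe↔

  baseAt-injective : Injective _≡_ _≡_ baseAt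
  baseAt-injective eq = trans (sym (Inverse.inverseʳ maybe↔ refl))
    (trans (cong (Inverse.from maybe↔) eq) (Inverse.inverseʳ maybe↔ refl))

  bases : List (Maybe V)
  bases = tabulate baseAt

  length-bases : length bases ≡ suc order
  length-bases = length-tabulate baseAt

  ∈-bases : ∀ u → u ∈ bases
  ∈-bases u = subst (_∈ bases) (Inverse.inverseˡ maybe↔ refl) (∈-tabulate⁺ {f = baseAt} (Inverse.from maybe↔ u))

  owner : V̂ → Maybe V
  owner (base u)      = u
  owner (pendant u _) = u

  owner-N[] : ∀ {u i v} → pendant u i ∈N[ v ] → owner v ≡ u
  owner-N[] (inj₁ refl)         = refl
  owner-N[] (inj₂ base-pendant) = refl

  -- Vertices dominating pendants of different base vertices have different owners, so choosing one
  -- for each base vertex is injective.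
  order<∣S∣ : ∀ {S} → Dominating graph S → order < ∣ S ∣
  order<∣S∣ {S} dom = injective⇒≤∣p∣ S
    (λ {i} {j} eq → baseAt-injective
      (trans (sym (owner-N[] (proj₂ (proj₂ (dom (leaf i))))))
      (trans (cong owner (index-injective {proj₁ (dom (leaf i))} {proj₁ (dom (leaf j))} eq))
             (owner-N[] (proj₂ (proj₂ (dom (leaf j))))))))
    (λ i → proj₁ (proj₂ (dom (leaf i))))
    where
    leaf : Fin (suc order) → V̂
    leaf i = pendant (baseAt i) somePendant

  order<γ : order < γ graph
  order<γ = let (S , dom , ∣S∣≡γ) , _ = proj₂ (dominationNumber-exists graph)
            in subst (order <_) ∣S∣≡γ (order<∣S∣ dom)

  -- The Z-domination game on Ĝ

  module _ where
    open ZDominationGame graph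
    open GameProperties graph {_∈N⟨_⟩} (λ u v → v ~̂? u) inj₂

    neighbour : ∀ u → ∃ λ v → u ∈N⟨ v ⟩
    neighbour (base u)      = pendant u somePendant , pendant-base
    neighbour (pendant u _) = base u , base-pendant

    -- w dominates all base vertices, so only a base vertex can still dominate something new.
    legal-after-w : ∀ {moves v} → w ∈ moves → Legal moves v → ∃ λ u → v ≡ base u × base u ∉ moves
    legal-after-w w∈ (w , _ , ¬d)     = contradiction (lose w∈ (inj₁ refl)) ¬d
    legal-after-w w∈ (old _ , _ , ¬d) = contradiction (lose w∈ (inj₂ w-old)) ¬d
    legal-after-w w∈ (pendant u i , base-pendant , ¬d) =
      u , refl , λ u∈ → ¬d (lose u∈ (inj₂ base-pendant))

    -- Whoever moves and however, a legal move is an unplayed base vertex and removes it from `L`.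
    value-after-w : ∀ {p moves m} L → w ∈ moves → (∀ {u} → base u ∉ moves → u ∈ L) →
                    Value p moves m → m ≤ length L
    value-after-w L w∈ unplayed∈L (end _) = z≤n
    value-after-w L w∈ unplayed∈L (move _ next v lv _)
      with u , refl , u∉ ← legal-after-w w∈ lv
      with L′ , L↭ ← ∈⇒↭∷ (unplayed∈L u∉) =
      ≤-trans (s≤s (value-after-w L′ (there w∈) unplayed∈L′ (next v lv)))
              (≤-reflexive (sym (↭-length L↭)))
      where
      unplayed∈L′ : ∀ {u′} → base u′ ∉ base u ∷ _ → u′ ∈ L′
      unplayed∈L′ u′∉ with ∈-resp-↭ L↭ (unplayed∈L (u′∉ ∘ there))
      ... | here refl   = contradiction (here refl) u′∉
      ... | there u′∈L′ = u′∈L′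

    γ≤γZg : γ graph ≤ γZg graph
    γ≤γZg = γ≤value neighbour (proj₂ (value-exists dominator []))

    γZg≤1+order : γZg graph ≤ suc order
    γZg≤1+order =
      -- Dominator opens with `w`, legal because its own pendant is undominated.
      let k , value , γZg≤1+k = any-move (proj₂ (value-exists dominator []))
            (pendant nothing somePendant , base-pendant , λ ())
      in ≤-trans γZg≤1+k (s≤s (≤-trans
           (value-after-w olds (here refl) unplayed∈olds value)
           (≤-reflexive (length-tabulate (baseAt ∘ suc)))))
      where
      olds : List (Maybe V)
      olds = tabulate (baseAt ∘ suc)

      unplayed∈olds : ∀ {u} → base u ∉ w ∷ [] → u ∈ olds
      unplayed∈olds {u} u∉ with ∈-bases u
      -- The head of `bases` is `nothing`, that is `w`, which has been played.
      ... | here refl  = contradiction (here refl) u∉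
      ... | there u∈   = u∈

  γ≡1+order : γ graph ≡ suc order
  γ≡1+order = ≤-antisym (≤-trans γ≤γZg γZg≤1+order) order<γ

  γZg≡1+order : γZg graph ≡ suc order
  γZg≡1+order = ≤-antisym γZg≤1+order (≤-trans order<γ γ≤γZg)

  -- The domination game on Ĝ: upper bound

  open DominationGame graph
  open GameProperties graph {_∈N[_]} _∈N[_]? (λ u∈N[v] → u∈N[v])

  γg≤1+order*2 : γg graph ≤ suc (order * 2)
  γg≤1+order*2 = ≤-trans
    (dominator-covers graph (map inj₁ bases) (λ u → inj₂ (covered u)) (proj₂ (value-exists dominator [])))
    (≤-reflexive (cong (λ k → k * 2 ∸ 1) (trans (length-map inj₁ bases) length-bases)))
    where
    covered : ∀ u → Dominated (map inj₁ bases) u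
    covered (base u)      = lose (∈-map⁺ inj₁ (∈-bases u)) (inj₁ refl)
    covered (pendant u _) = lose (∈-map⁺ inj₁ (∈-bases u)) (inj₂ base-pendant)

  -- The domination game on Ĝ: Staller's weight strategy

  playedAt : List V̂ → Maybe V → List V̂
  playedAt moves u = filter (λ v → owner v ≟ᴹ u) moves

  -- Moves at `base u` count too, so this is `c(u)` as long as `base u` is unplayed.
  load : List V̂ → Maybe V → ℕ
  load moves u = length (playedAt moves u)

  load-≡ : ∀ moves v {u} → owner v ≡ u → load (v ∷ moves) u ≡ suc (load moves u)
  load-≡ moves v {u} eq = cong length (filter-accept (λ x → owner x ≟ᴹ u) {v} {moves} eq)

  load-≢ : ∀ moves v {u} → owner v ≢ u → load (v ∷ moves) u ≡ load moves u
  load-≢ moves v {u} neq = cong length (filter-reject (λ x → owner x ≟ᴹ u) {v} {moves} neq)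

  load-∷≤ : ∀ moves v {u} → load (v ∷ moves) u ≤ suc (load moves u)
  load-∷≤ moves v {u} with owner v ≟ᴹ u
  ... | yes _ = ≤-refl
  ... | no  _ = n≤1+n _

  -- With `base u` unplayed, a pendant at `u` is dominated only by being played itself, and
  -- `exponent + 1` such moves would exceed the load.
  free-pendant : ∀ {moves u} → base u ∉ moves → load moves u ≤ exponent →
                 ∃ λ i → ¬ Dominated moves (pendant u i)
  free-pendant {moves} {u} u∉ load≤ with Fin.any? (λ i → ¬? (dominated? moves (pendant u i)))
  ... | yes free  = free
  ... | no ¬free = contradiction
    (≤-trans pendants≤load load≤)
    (<⇒≱ (≤-reflexive (+-comm 1 exponent)))
    where
    played : ∀ i → pendant u i ∈ moves
    played i with find (decidable-stable (dominated? moves (pendant u i)) λ ¬d → ¬free (i , ¬d))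
    ... | _ , v∈ , inj₁ refl         = v∈
    ... | _ , v∈ , inj₂ base-pendant = contradiction v∈ u∉

    pendants≤load : pendants ≤ load moves u
    pendants≤load = injective⇒≤length (playedAt moves u) (λ { refl → refl })
      (λ i → ∈-filter⁺ (λ v → owner v ≟ᴹ u) (played i) refl)

  weight : List V̂ → List (Maybe V) → ℕ
  weight moves L = sum (map (λ u → 2 ^ load moves u) L)

  weight-↭ : ∀ moves {L L′} → L ↭ L′ → weight moves L ≡ weight moves L′
  weight-↭ _ L↭L′ = sum-↭ (map⁺ _ L↭L′)

  -- A move changes the load of its owner only.
  weight-∉ : ∀ moves v L → owner v ∉ L → weight (v ∷ moves) L ≡ weight moves L
  weight-∉ moves v L v∉L = cong sum (map-cong-local {xs = L} (All.tabulate λ u∈L →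
    cong (2 ^_) (load-≢ moves v λ { refl → v∉L u∈L })))

  0<2^ : ∀ k → 0 < 2 ^ k
  0<2^ = m^n>0 2

  2^load≤weight : ∀ moves {L u} → u ∈ L → 2 ^ load moves u ≤ weight moves L
  2^load≤weight moves u∈L with L′ , L↭ ← ∈⇒↭∷ u∈L =
    ≤-trans (m≤m+n _ _) (≤-reflexive (sym (weight-↭ moves L↭)))

  minimum∣weight : ∀ moves {k} L → (∀ {u} → u ∈ L → k ≤ load moves u) → 2 ^ k ∣ weight moves L
  minimum∣weight moves []      k≤ = _ ∣0
  minimum∣weight moves (u ∷ L) k≤ =
    ∣m∣n⇒∣m+n (2^-mono-∣ (k≤ (here refl))) (minimum∣weight moves L (k≤ ∘ there))

  -- Staller's invariant before a move of Dominator; `L` holds the base vertices she still counts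
  -- on.
  record Balanced (moves : List V̂) (L : List (Maybe V)) : Set where
    field
      unique   : Unique L
      unplayed : ∀ {u} → u ∈ L → base u ∉ moves
      light    : weight moves L ≤ 2 ^ exponent
  open Balanced

  Reply : List V̂ → ℕ → Set
  Reply moves k = ∃₂ λ s L → Legal moves s × Balanced (s ∷ moves) L × length L ≡ k

  -- A pendant at a base vertex of minimum load k raises the weight by 2^k;
  -- as 2^k divides the weight and the bound, strict inequality leaves room for it.
  reply-pendant : ∀ {moves u L} → Unique (u ∷ L) → (∀ {v} → v ∈ u ∷ L → base v ∉ moves) →
                  weight moves (u ∷ L) < 2 ^ exponent → Reply moves (suc (length L))
  reply-pendant {moves} {u} {L} uniq unpl weight<
    with t , t∈ , t-min ← minimiser (load moves) u L
    with L′ , L↭ ← ∈⇒↭∷ t∈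
    with i , ¬d ← free-pendant (unpl t∈) (2^-cancel-≤ (≤-trans (2^load≤weight moves t∈) (<⇒≤ weight<))) =
    pendant t i , u ∷ L , (pendant t i , inj₁ refl , ¬d) ,
    record
      { unique   = uniq
      ; unplayed = λ { v∈ (there v∈moves) → unpl v∈ v∈moves }
      ; light    = begin
          weight moves′ (u ∷ L)                      ≡⟨ weight-↭ moves′ L↭ ⟩
          2 ^ load moves′ t + weight moves′ L′       ≡⟨ cong₂ (λ a b → 2 ^ a + b) (load-≡ moves (pendant t i) refl)
                                                                        (weight-∉ moves (pendant t i) L′ t∉L′) ⟩
          2 * 2 ^ load moves t + weight moves L′     ≡⟨ cong (λ a → 2 ^ load moves t + a + weight moves L′) (+-identityʳ _) ⟩
          2 ^ load moves t + 2 ^ load moves t + weight moves L′ ≡⟨ +-assoc (2 ^ load moves t) _ _ ⟩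
          2 ^ load moves t + weight moves (t ∷ L′)   ≡⟨ cong (λ a → 2 ^ load moves t + a) (weight-↭ moves L↭) ⟨
          2 ^ load moves t + weight moves (u ∷ L)    ≤⟨ ∣∧<⇒+≤ (minimum∣weight moves (u ∷ L) t-min)
                                                          (2^-mono-∣ (<⇒≤ t<)) weight< ⟩
          2 ^ exponent                               ∎
      } ,
    refl
    where
    open ≤-Reasoning
    moves′ = pendant t i ∷ moves

    t∉L′ : t ∉ L′
    t∉L′ t∈L′ with t≢ ∷ _ ← Unique-resp-↭ L↭ uniq = All.lookup t≢ t∈L′ refl

    t< : load moves t < exponent
    t< = 2^-cancel-< (≤-<-trans (2^load≤weight moves t∈) weight<)

  -- A second entry of `L` has positive weight, which makes the bound strict. This leaves a free
  -- pendant at `u` even after one more move there.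
  load<exponent : ∀ {moves L u} → Balanced moves L → u ∈ L → 2 ≤ length L → load moves u < exponent
  load<exponent {moves} {L} {u} bal u∈ 2≤len with ∈⇒↭∷ u∈
  ... | []     , L↭ = contradiction (≤-trans 2≤len (≤-reflexive (↭-length L↭))) λ { (s≤s ()) }
  ... | x ∷ L′ , L↭ = 2^-cancel-< (begin-strict
    2 ^ load moves u                        <⟨ m<m+n _ (≤-trans (0<2^ (load moves x)) (m≤m+n _ _)) ⟩
    2 ^ load moves u + weight moves (x ∷ L′) ≡⟨ weight-↭ moves L↭ ⟨
    weight moves L                          ≤⟨ light bal ⟩
    2 ^ exponent                            ∎)
    where open ≤-Reasoning

  -- When v has left all of L unplayed, Dominator has wasted a turn, so Staller can afford to play
  -- t herself; choosing t as the owner of v discards the weight that v may have added.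
  reply-base : ∀ {moves v t L} → Balanced moves L → (∀ {u} → u ∈ L → base u ≢ v) →
               t ∈ L → (∀ {u} → u ∈ L → owner v ≡ u → u ≡ t) →
               2 ≤ length L → Reply (v ∷ moves) (length L ∸ 1)
  reply-base {moves} {v} {t} {L} bal v≢ t∈ v-owner 2≤len
    with L′ , L↭ ← ∈⇒↭∷ t∈
    with i , ¬d ← free-pendant {v ∷ moves} {t}
           (λ { (here eq) → v≢ t∈ eq ; (there t∈moves) → unplayed bal t∈ t∈moves })
           (≤-trans (load-∷≤ moves v) (load<exponent bal t∈ 2≤len)) =
    base t , L′ , (pendant t i , inj₂ base-pendant , ¬d) ,
    record
      { unique   = proj₂ L′-unique
      ; unplayed = λ where
          u∈ (here refl)            → t∉L′ u∈
          u∈ (there (here eq))      → v≢ (L′⊆L u∈) eq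
          u∈ (there (there u∈moves)) → unplayed bal (L′⊆L u∈) u∈moves
      ; light    = begin
          weight (base t ∷ v ∷ moves) L′     ≡⟨ weight-∉ (v ∷ moves) (base t) L′ t∉L′ ⟩
          weight (v ∷ moves) L′              ≡⟨ weight-∉ moves v L′ (λ o∈ →
                                                   t∉L′ (subst (_∈ L′) (v-owner (L′⊆L o∈) refl) o∈)) ⟩
          weight moves L′                    ≤⟨ m≤n+m _ _ ⟩
          2 ^ load moves t + weight moves L′ ≡⟨ weight-↭ moves L↭ ⟨
          weight moves L                     ≤⟨ light bal ⟩
          2 ^ exponent                       ∎
      } ,
    cong (_∸ 1) (sym (↭-length L↭))
    where
    open ≤-Reasoning

    L′⊆L : ∀ {u} → u ∈ L′ → u ∈ L
    L′⊆L = ∈-resp-↭ (↭-sym L↭) ∘ there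

    L′-unique : t ∉ L′ × Unique L′
    L′-unique with t≢ ∷ uniq ← Unique-resp-↭ L↭ (unique bal) = (λ t∈L′ → All.lookup t≢ t∈L′ refl) , uniq

    t∉L′ : t ∉ L′
    t∉L′ = proj₁ L′-unique

  reply : ∀ {moves L k} v → Balanced moves L → length L ≡ suc (suc k) → Reply (v ∷ moves) (suc k)
  reply {L = L} v bal len with owner v ∈? L
  -- A base vertex of `L` takes its positive weight with it, so the bound becomes strict and a
  -- pendant reply is affordable.
  reply {moves} {L} (base u) bal len | yes u∈ with ∈⇒↭∷ u∈
  ... | []     , L↭ = contradiction (trans (sym len) (↭-length L↭)) λ ()
  ... | x ∷ L′ , L↭ with u≢ ∷ uniq ← Unique-resp-↭ L↭ (unique bal) =
    subst (Reply (base u ∷ moves)) (suc-injective (trans (sym (↭-length L↭)) len))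
      (reply-pendant uniq
        (λ where
          v∈ (here refl)     → All.lookup u≢ v∈ refl
          v∈ (there v∈moves) → unplayed bal (∈-resp-↭ (↭-sym L↭) (there v∈)) v∈moves)
        (begin-strict
          weight (base u ∷ moves) (x ∷ L′)         ≡⟨ weight-∉ moves (base u) (x ∷ L′) (λ u∈ → All.lookup u≢ u∈ refl) ⟩
          weight moves (x ∷ L′)                    <⟨ m<n+m _ (0<2^ (load moves u)) ⟩
          2 ^ load moves u + weight moves (x ∷ L′) ≡⟨ weight-↭ moves L↭ ⟨
          weight moves L                           ≤⟨ light bal ⟩
          2 ^ exponent                             ∎))
    where open ≤-Reasoning
  -- A pendant at `u` doubles the weight of `u`; Staller plays `u` itself and removes that weight.
  reply {moves} {L} v@(pendant u i) bal len | yes u∈ =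
    subst (Reply (v ∷ moves)) (cong (_∸ 1) len)
      (reply-base bal (λ _ ()) u∈ (λ _ → sym) (subst (2 ≤_) (sym len) (s≤s (s≤s z≤n))))
  -- This move changes no load in `L`, so Staller may take any entry, here the head.
  reply {moves} {L@(t ∷ _)} v bal len | no v∉ =
    subst (Reply (v ∷ moves)) (cong (_∸ 1) len)
      (reply-base bal (λ { u∈ refl → v∉ u∈ }) (here refl) (λ { u∈ refl → contradiction u∈ v∉ })
        (subst (2 ≤_) (sym len) (s≤s (s≤s z≤n))))

  -- Induction on rounds, each a move of Dominator and a reply; `suc m` allows for the missing reply
  -- in the last round.
  balanced⇒≤value : ∀ k {moves L m} → Balanced moves L → length L ≡ k →
                    Value dominator moves m → k * 2 ≤ suc m
  balanced⇒≤value zero    bal len value = z≤n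
  balanced⇒≤value (suc k) {moves} {L@(u ∷ _)} bal len value
    -- A free pendant shows that the game is not over, so Dominator does move.
    with i , ¬d ← free-pendant (unplayed bal (here refl))
           (2^-cancel-≤ (≤-trans (2^load≤weight moves {L} (here refl)) (light bal)))
    with v , m , value′ , refl ← optimal-move value (pendant u i , inj₁ refl , ¬d)
    with k
  ... | zero   = s≤s (s≤s z≤n)
  ... | suc k′ =
    let s , L′ , legal , bal′ , len′ = reply v bal len
        m′ , value″ , m′<m = any-move value′ legal
    in s≤s (s≤s (≤-trans (balanced⇒≤value (suc k′) bal′ len′ value″) m′<m))

  -- Every load is 0, so each base vertex weighs 1; the number of pendants is chosen to make this
  -- total fit.
  initially-balanced : Balanced [] bases
  initially-balanced = record
    { unique   = Unique.tabulate⁺ baseAt-injective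
    ; unplayed = λ _ ()
    ; light    = begin
        weight [] bases        ≡⟨ weight-[] bases ⟩
        length bases           ≡⟨ length-bases ⟩
        suc order              ≡⟨ +-comm 1 order ⟩
        order + 1              ≤⟨ n≤2^⌈log₂n⌉ (order + 1) ⟩
        2 ^ exponent           ∎
    }
    where
    open ≤-Reasoning
    weight-[] : ∀ L → weight [] L ≡ length L
    weight-[] []      = refl
    weight-[] (u ∷ L) = cong suc (weight-[] L)

  -- Combining the bounds

  γg+1≡[1+order]*2 : γg graph + 1 ≡ suc order * 2
  γg+1≡[1+order]*2 = trans (+-comm (γg graph) 1) (≤-antisym
    (s≤s γg≤1+order*2)
    (balanced⇒≤value (suc order) initially-balanced length-bases
      (proj₂ (value-exists dominator []))))

proposition6p1 : (G : Graph) → 3 ≤ Graph.order G →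
    γZg (hat G) ≡ γ (hat G) × (+ γ (hat G)) / 1 ≡ (+ (γg (hat G) + 1)) / 2
proposition6p1 G _ =
  trans γZg≡1+order (sym γ≡1+order) ,
  m/1≡n/2 (γ (hat G)) (γg (hat G) + 1) (trans (cong (_* 2) γ≡1+order) (sym γg+1≡[1+order]*2))
  where open HatProperties G
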